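{- Let $\mathcal{P}=(|K|,V)$ be a polyhedral model and $x_1,x_2\in|K|$. Then $x_1\equiv_\eta x_2$ if and only if $x_1\approx_\triangle x_2$.
   Context: Fix a set PL of proposition letters. A simplex $\sigma\subseteq\mathbb{R}^m$ is the convex hull of $d+1$ affinely independent points; its faces are the simplices spanned by nonempty subsets of its vertices; its relative interior (cell) is $\tilde\sigma=\{\sum_i\lambda_iv_i:\lambda_i\in(0,1],\sum_i\lambda_i=1\}$. A simplicial complex $K$ is a finite set of simplices in $\mathbb{R}^m$ closed under faces, any two of which intersect in a common face or in $\emptyset$. The polyhedron $|K|$ is the union of its simplices with the subspace topology; the cells partition $|K|$. A polyhedral model is $\mathcal{P}=(|K|,V)$ with $V:\mathrm{PL}\to\mathcal{P}(|K|)$, each $V(p)$ a union of cells. A topological path from $x$ is a continuous $\pi:[0,1]\to|K|$ with $\pi(0)=x$. SLCS$_\eta$ formulas: $\Phi::=p\mid\neg\Phi\mid\Phi_1\wedge\Phi_2\mid\eta(\Phi_1,\Phi_2)$; $x\models p$ iff $x\in V(p)$; negation, conjunction standard; $x\models\eta(\Phi_1,\Phi_2)$ iff some topological path $\pi$ from $x$ has $\pi(1)\models\Phi_2$ and $\pi(r)\models\Phi_1$ for all $r\in[0,1)$. $x_1\equiv_\eta x_2$ means $x_1,x_2$ satisfy the same SLCS$_\eta$ formulas. A weak simplicial bisimulation is a symmetric relation $B\subseteq|K|\times|K|$ such that whenever $B(x_1,x_2)$: (1) for all $p$, $x_1\in V(p)$ iff $x_2\in V(p)$; (2) for each topological path $\pi_1$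 from $x_1$ there is a topological path $\pi_2$ from $x_2$ with $B(\pi_1(1),\pi_2(1))$ and such that for all $r_2\in[0,1)$ there is $r_1\in[0,1)$ with $B(\pi_1(r_1),\pi_2(r_2))$. $x_1\approx_\triangle x_2$ iff some weak simplicial bisimulation contains $(x_1,x_2)$. -}

module Defs where

open import Algebra.Bundles using (CommutativeRing)
open import Data.List.Base using (List)
open import Data.List.Membership.Propositional using () renaming (_∈_ to _∈ᴸ_)
open import Data.List.Relation.Unary.Any using (Any)
open import Data.Fin.Base using (Fin)
open import Data.Nat.Base using (ℕ; suc)
open import Data.Product.Base using (Σ; Σ-syntax; ∃; ∃-syntax; _×_; _,_; proj₁; proj₂)
open import Data.Sum.Base using (_⊎_; inj₁; inj₂)
open import Data.Vec.Functional using (Vector)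
open import Function.Bundles using (Func; _⇔_)
open import Level using (0ℓ) renaming (suc to lsuc)
open import Relation.Binary.Bundles using (Setoid)
open import Relation.Binary.Core using (Rel)
open import Relation.Binary.Definitions using (Symmetric; _Respects₂_)
open import Relation.Binary.Structures using (IsTotalOrder)
open import Relation.Nullary.Negation using (¬_)
open import Relation.Unary using (Pred; _∈_; _∩_; _≐_; Empty)
import Algebra.Properties.Ring as RingProperties
import Algebra.Properties.Semiring.Sum as Sum
import Data.Vec.Functional.Relation.Binary.Equality.Setoid as VecEquality
import Relation.Binary.Construct.NonStrictToStrict as ToStrict
import Relation.Binary.Construct.On as On

-- The standard library has no real numbers, so they are given by their
-- characterisation, up to isomorphism, as a Dedekind-complete ordered field.

record CompleteOrderedField : Set₁ where
  infix 4 _≤_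
  field
    commutativeRing : CommutativeRing 0ℓ 0ℓ

  open CommutativeRing commutativeRing public

  field
    _≤_          : Rel Carrier 0ℓ
    isTotalOrder : IsTotalOrder _≈_ _≤_
    +-monoˡ-≤    : ∀ z {x y} → x ≤ y → x + z ≤ y + z
    *-nonNeg     : ∀ {x y} → 0# ≤ x → 0# ≤ y → 0# ≤ x * y
    0≉1          : ¬ (0# ≈ 1#)
    inverse      : ∀ x → ¬ (x ≈ 0#) → ∃[ y ] x * y ≈ 1#

  UpperBound : Pred Carrier 0ℓ → Pred Carrier 0ℓ
  UpperBound P u = ∀ x → x ∈ P → x ≤ u

  field
    complete : (P : Pred Carrier 0ℓ) → ∃ P → ∃ (UpperBound P) →
               ∃[ s ] (UpperBound P s × (∀ u → UpperBound P u → s ≤ u))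

  open ToStrict _≈_ _≤_ public using (_<_)

infix  8 ¬ᶠ_
infixr 7 _∧ᶠ_

data Formula (PL : Set) : Set where
  var  : PL → Formula PL
  ¬ᶠ_  : Formula PL → Formula PL
  _∧ᶠ_ : Formula PL → Formula PL → Formula PL
  η    : Formula PL → Formula PL → Formula PL

module Polyhedral (ℝ : CompleteOrderedField) where

  open CompleteOrderedField ℝ
  open RingProperties ring using (-1*x≈-x; -‿involutive)
  open Sum semiring using (sum)
  open VecEquality setoid using (_≋_; ≋-setoid)

  ℝ^ : ℕ → Set
  ℝ^ m = Vector Carrier m

  combination : ∀ {m n} → Vector Carrier n → Vector (ℝ^ m) n → ℝ^ m
  combination c v j = sum (λ i → c i * v i j)

  AffinelyIndependent : ∀ {m n} → Vector (ℝ^ m) n → Set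
  AffinelyIndependent v =
    ∀ c → sum c ≈ 0# → combination c v ≋ (λ _ → 0#) → ∀ i → c i ≈ 0#

  -- A simplex is given by an enumeration of its vertices; the enumeration is
  -- not part of the simplex, so simplices are compared by _≐_ on hulls.
  record Simplex (m : ℕ) : Set where
    field
      dim         : ℕ
      vertex      : Vector (ℝ^ m) (suc dim)
      independent : AffinelyIndependent vertex

  open Simplex public

  hull : ∀ {m} → Simplex m → Pred (ℝ^ m) 0ℓ
  hull σ x = ∃[ c ] ((∀ i → 0# ≤ c i) × sum c ≈ 1# × x ≋ combination c (vertex σ))

  cell : ∀ {m} → Simplex m → Pred (ℝ^ m) 0ℓ
  cell σ x =
    ∃[ c ] ((∀ i → 0# < c i × c i ≤ 1#) × sum c ≈ 1# × x ≋ combination c (vertex σ))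

  IsFace : ∀ {m} → Simplex m → Simplex m → Set
  IsFace τ σ = ∀ i → ∃[ j ] vertex τ i ≋ vertex σ j

  record SimplicialComplex (m : ℕ) : Set where
    field
      simplices   : List (Simplex m)
      face-closed : ∀ {σ} → σ ∈ᴸ simplices → ∀ τ → IsFace τ σ →
                    Any (λ ρ → hull ρ ≐ hull τ) simplices
      meet        : ∀ {σ τ} → σ ∈ᴸ simplices → τ ∈ᴸ simplices →
                    Empty (hull σ ∩ hull τ) ⊎
                    (∃[ ρ ] (IsFace ρ σ × IsFace ρ τ × (hull σ ∩ hull τ) ≐ hull ρ))

  open SimplicialComplex public

  Point : ∀ {m} → SimplicialComplex m → Set
  Point {m} K = Σ[ x ∈ ℝ^ m ] Any (λ σ → x ∈ hull σ) (simplices K)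

  polyhedron : ∀ {m} → SimplicialComplex m → Setoid 0ℓ 0ℓ
  polyhedron {m} K = On.setoid {B = Point K} (≋-setoid m) proj₁

  infix 4 _≈ᴷ_
  _≈ᴷ_ : ∀ {m} {K : SimplicialComplex m} → Rel (Point K) 0ℓ
  _≈ᴷ_ {K = K} = Setoid._≈_ (polyhedron K)

  UnionOfCells : ∀ {m} {K : SimplicialComplex m} → Pred (Point K) 0ℓ → Set₁
  UnionOfCells {m} {K} P =
    Σ[ S ∈ Pred (Simplex m) 0ℓ ]
      P ≐ (λ x → Any (λ σ → σ ∈ S × proj₁ x ∈ cell σ) (simplices K))

  record PolyhedralModel {m : ℕ} (K : SimplicialComplex m) (PL : Set) : Set₁ where
    field
      V            : PL → Pred (Point K) 0ℓ
      unionOfCells : ∀ p → UnionOfCells {K = K} (V p)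

  open PolyhedralModel public

  UnitInterval : Set
  UnitInterval = Σ[ r ∈ Carrier ] (0# ≤ r × r ≤ 1#)

  [0,1] : Setoid 0ℓ 0ℓ
  [0,1] = On.setoid {B = UnitInterval} setoid proj₁

  open IsTotalOrder isTotalOrder
    using (total; ≤-respˡ-≈; ≤-respʳ-≈) renaming (refl to ≤-refl)

  0≤1 : 0# ≤ 1#
  0≤1 with total 0# 1#
  ... | inj₁ 0≤1 = 0≤1
  ... | inj₂ 1≤0 = ≤-respʳ-≈ [-1]²≈1 (*-nonNeg 0≤-1 0≤-1)
    where
    0≤-1 : 0# ≤ - 1#
    0≤-1 = ≤-respˡ-≈ (-‿inverseʳ 1#) (≤-respʳ-≈ (+-identityˡ (- 1#)) (+-monoˡ-≤ (- 1#) 1≤0))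

    [-1]²≈1 : - 1# * - 1# ≈ 1#
    [-1]²≈1 = trans (-1*x≈-x (- 1#)) (-‿involutive 1#)

  0ᴵ 1ᴵ : UnitInterval
  0ᴵ = 0# , ≤-refl , 0≤1
  1ᴵ = 1# , 0≤1 , ≤-refl

  _<1 : Pred UnitInterval 0ℓ
  r <1 = proj₁ r < 1#

  -- | x - y | < ε
  Near : Carrier → Rel Carrier 0ℓ
  Near ε x y = x < y + ε × y < x + ε

  -- Continuity for the subspace topology, ℝ^m carrying the product topology,
  -- which is that of the metric max_j |x_j - y_j|.
  Continuous : ∀ {m} {K : SimplicialComplex m} → (UnitInterval → Point K) → Set
  Continuous π =
    ∀ r ε → 0# < ε → ∃[ δ ] (0# < δ ×
      (∀ s → Near δ (proj₁ r) (proj₁ s) → ∀ j → Near ε (proj₁ (π r) j) (proj₁ (π s) j)))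

  record Path {m : ℕ} (K : SimplicialComplex m) : Set where
    field
      func       : Func [0,1] (polyhedron K)
      continuous : Continuous {K = K} (Func.to func)

    open Func func public using () renaming (to to at; cong to at-cong)

  open Path public using (at)

  PathFrom : ∀ {m} {K : SimplicialComplex m} → Point K → Set
  PathFrom {K = K} x = Σ[ π ∈ Path K ] _≈ᴷ_ {K = K} (at π 0ᴵ) x

  module _ {m : ℕ} {K : SimplicialComplex m} {PL : Set} where

    infix 4 _⊨[_]_ _≡η[_]_ _≈△[_]_

    _⊨[_]_ : Point K → PolyhedralModel K PL → Formula PL → Set
    x ⊨[ 𝒫 ] var p     = x ∈ V 𝒫 p
    x ⊨[ 𝒫 ] (¬ᶠ Φ)    = ¬ (x ⊨[ 𝒫 ] Φ)
    x ⊨[ 𝒫 ] (Φ ∧ᶠ Ψ)  = x ⊨[ 𝒫 ] Φ × x ⊨[ 𝒫 ] Ψ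
    x ⊨[ 𝒫 ] η Φ Ψ     =
      Σ[ (π , _) ∈ PathFrom {K = K} x ]
        (at π 1ᴵ ⊨[ 𝒫 ] Ψ × (∀ r → r <1 → at π r ⊨[ 𝒫 ] Φ))

    _≡η[_]_ : Point K → PolyhedralModel K PL → Point K → Set
    x₁ ≡η[ 𝒫 ] x₂ = ∀ Φ → (x₁ ⊨[ 𝒫 ] Φ) ⇔ (x₂ ⊨[ 𝒫 ] Φ)

    record IsWeakSimplicialBisimulation
             (𝒫 : PolyhedralModel K PL) (B : Rel (Point K) 0ℓ) : Set where
      field
        -- B is a relation on the setoid of points
        resp  : B Respects₂ _≈ᴷ_ {K = K}
        sym   : Symmetric B
        atoms : ∀ {x₁ x₂} → B x₁ x₂ → ∀ p → (x₁ ∈ V 𝒫 p) ⇔ (x₂ ∈ V 𝒫 p)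
        paths : ∀ {x₁ x₂} → B x₁ x₂ →
                ∀ ((π₁ , _) : PathFrom {K = K} x₁) →
                Σ[ (π₂ , _) ∈ PathFrom {K = K} x₂ ]
                  (B (at π₁ 1ᴵ) (at π₂ 1ᴵ) ×
                   (∀ r₂ → r₂ <1 → ∃[ r₁ ] (r₁ <1 × B (at π₁ r₁) (at π₂ r₂))))

    _≈△[_]_ : Point K → PolyhedralModel K PL → Point K → Set₁
    x₁ ≈△[ 𝒫 ] x₂ =
      Σ[ B ∈ Rel (Point K) 0ℓ ] (IsWeakSimplicialBisimulation 𝒫 B × B x₁ x₂)

{-# OPTIONS --safe #-}
module Submission where

open import Defs
open import Axiom.ExcludedMiddle using (ExcludedMiddle)
open import Data.Nat.Base using (ℕ; zero; suc)
open import Data.Fin.Base using (Fin; zero; suc; punchIn)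
open import Data.Fin.Properties using (any?; _≟_)
open import Data.List.Base using ([]; _∷_)
open import Data.List.Membership.Propositional using (find; lose) renaming (_∈_ to _∈ᴸ_)
open import Data.List.Relation.Unary.Any using (Any; here; there; map)
open import Data.Product.Base using (Σ-syntax; ∃-syntax; _×_; _,_; proj₁; proj₂; swap)
open import Data.Sum.Base using (_⊎_; inj₁; inj₂)
open import Data.Vec.Functional using (Vector; insertAt; removeAt; replicate)
open import Data.Vec.Functional.Properties using (insertAt-lookup; insertAt-punchIn)
open import Function.Bundles using (_⇔_; mk⇔; module Equivalence)
open import Function.Properties.Equivalence using () renaming (refl to ⇔-refl; sym to ⇔-sym; trans to ⇔-trans)
open import Level using (0ℓ)
open import Relation.Binary.Bundles using (TotalOrder)
open import Relation.Binary.Core using (Rel)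
open import Relation.Nullary.Decidable using (yes; no; decidable-stable)
open import Relation.Nullary.Negation using (¬_; contradiction)
open import Relation.Unary using (Pred; _∈_; _⊆_; _≐_)
import Relation.Binary.PropositionalEquality as ≡
import Algebra.Construct.NaturalChoice.Max as Max
import Algebra.Construct.NaturalChoice.Min as Min
import Algebra.Properties.CommutativeSemigroup as CommutativeSemigroupProperties
import Algebra.Properties.Group as GroupProperties
import Algebra.Properties.Ring as RingProperties
import Algebra.Properties.Semiring.Sum as SemiringSum
import Data.Sum.Base as Sum
import Data.Vec.Functional.Relation.Binary.Equality.Setoid as VecEquality
import Relation.Binary.Construct.NonStrictToStrict as ToStrict
import Relation.Binary.Reasoning.PartialOrder as PosetReasoning

-- A bisimulation preserves formulas by induction. Conversely, ≡η is itself a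
-- bisimulation. The key point is that the truth of a formula is constant on cells:
-- cells are convex, so a path from x can be preceded by a segment from any other point
-- of the cell of x. There are finitely many cells, so every ≡η-class has a characteristic
-- formula, and so does every union of classes. Given x₁ ≡η x₂ and a path π from x₁, let Φ
-- define the union of the classes met by π on [0,1) and let Ψ characterise the class of
-- π(1); then x₂ satisfies η Φ Ψ, and a witnessing path matches π.

-- Both notions ignore the order and the times at which a path meets the classes: only the set met
-- before parameter 1 and the class of the endpoint count. This is why a single formula η Φ Ψ
-- captures all that has to be matched about a path. The geometric obstacle is that a cell is
-- described through an enumeration of vertices, whereas simplices are identified by their hulls
-- only: closure under faces returns a simplex with the right hull but possibly another enumeration.
-- So it must be shown that a cell depends on the hull alone, and that two cells with a common point
-- coincide. Atoms are constant on cells for the latter reason. Points, too, are equal only up to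
-- `≋`. Truth respects `≋` because each point lies in a cell and cells are closed under `≋`.
-- Excluded middle serves to split off vanishing coordinates, to pick one representative per cell,
-- and to undo double negations.

-- Arithmetic and small positive quantities in an ordered field.

module OrderedField (ℝ : CompleteOrderedField) where

  open CompleteOrderedField ℝ hiding (zero)
  open RingProperties ring using (-‿distribʳ-*)
  open GroupProperties +-group using (//-rightDividesˡ; //-rightDividesʳ)
  open SemiringSum semiring using (sum; sum-remove)

  totalOrder : TotalOrder 0ℓ 0ℓ 0ℓ
  totalOrder = record { isTotalOrder = isTotalOrder }

  open TotalOrder totalOrder public
    using (poset; total; antisym; ≤-respʳ-≈)
    renaming (refl to ≤-refl; reflexive to ≤-reflexive; trans to ≤-trans)

  open PosetReasoning poset

  <⇒≤ : ∀ {x y} → x < y → x ≤ y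
  <⇒≤ = proj₁

  ≰⇒> : ∀ {x y} → ¬ (x ≤ y) → y < x
  ≰⇒> = ToStrict.≰⇒> _≈_ _≤_ sym ≤-reflexive total

  <⇒≱ : ∀ {x y} → x < y → ¬ (y ≤ x)
  <⇒≱ = ToStrict.<⇒≱ _≈_ _≤_ antisym

  <-≤-trans : ∀ {x y z} → x < y → y ≤ z → x < z
  <-≤-trans {x} {y} {z} x<y y≤z = begin-strict x <⟨ x<y ⟩ y ≤⟨ y≤z ⟩ z ∎

  +-monoʳ-≤ : ∀ z {x y} → x ≤ y → z + x ≤ z + y
  +-monoʳ-≤ z {x} {y} x≤y = begin
    z + x ≈⟨ +-comm z x ⟩
    x + z ≤⟨ +-monoˡ-≤ z x≤y ⟩
    y + z ≈⟨ +-comm y z ⟩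
    z + y ∎

  +-mono-≤ : ∀ {x y u v} → x ≤ y → u ≤ v → x + u ≤ y + v
  +-mono-≤ {y = y} {u} x≤y u≤v = ≤-trans (+-monoˡ-≤ u x≤y) (+-monoʳ-≤ y u≤v)

  +-cancelʳ-≤ : ∀ z {x y} → x + z ≤ y + z → x ≤ y
  +-cancelʳ-≤ z {x} {y} x+z≤y+z = begin
    x           ≈⟨ //-rightDividesʳ z x ⟨
    x + z - z   ≤⟨ +-monoˡ-≤ (- z) x+z≤y+z ⟩
    y + z - z   ≈⟨ //-rightDividesʳ z y ⟩
    y           ∎

  +-monoˡ-< : ∀ z {x y} → x < y → x + z < y + z
  +-monoˡ-< z x<y = ≰⇒> λ y+z≤x+z → <⇒≱ x<y (+-cancelʳ-≤ z y+z≤x+z)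

  +-mono-<-≤ : ∀ {x y u v} → x < y → u ≤ v → x + u < y + v
  +-mono-<-≤ {y = y} {u} x<y u≤v = <-≤-trans (+-monoˡ-< u x<y) (+-monoʳ-≤ y u≤v)

  +-mono-< : ∀ {x y u v} → x < y → u < v → x + u < y + v
  +-mono-< x<y u<v = +-mono-<-≤ x<y (<⇒≤ u<v)

  x<x+y : ∀ x {y} → 0# < y → x < x + y
  x<x+y x {y} 0<y = begin-strict
    x      ≈⟨ +-identityˡ x ⟨
    0# + x <⟨ +-monoˡ-< x 0<y ⟩
    y + x  ≈⟨ +-comm y x ⟩
    x + y  ∎

  x≤x+y : ∀ x {y} → 0# ≤ y → x ≤ x + y
  x≤x+y x {y} 0≤y = begin
    x      ≈⟨ +-identityʳ x ⟨
    x + 0# ≤⟨ +-monoʳ-≤ x 0≤y ⟩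
    x + y  ∎

  +-nonNeg : ∀ {x y} → 0# ≤ x → 0# ≤ y → 0# ≤ x + y
  +-nonNeg 0≤x 0≤y = ≤-trans 0≤x (x≤x+y _ 0≤y)

  +-pos-nonNeg : ∀ {x y} → 0# < x → 0# ≤ y → 0# < x + y
  +-pos-nonNeg 0<x 0≤y = <-≤-trans 0<x (x≤x+y _ 0≤y)

  x≤y⇒0≤y-x : ∀ {x y} → x ≤ y → 0# ≤ y - x
  x≤y⇒0≤y-x {x} {y} x≤y = begin
    0#    ≈⟨ -‿inverseʳ x ⟨
    x - x ≤⟨ +-monoˡ-≤ (- x) x≤y ⟩
    y - x ∎

  x≤0⇒0≤-x : ∀ {x} → x ≤ 0# → 0# ≤ - x
  x≤0⇒0≤-x x≤0 = ≤-respʳ-≈ (+-identityˡ _) (x≤y⇒0≤y-x x≤0)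

  *-monoˡ-≤-nonNeg : ∀ {z} → 0# ≤ z → ∀ {x y} → x ≤ y → x * z ≤ y * z
  *-monoˡ-≤-nonNeg {z} 0≤z {x} {y} x≤y = begin
    x * z                ≤⟨ x≤x+y _ (*-nonNeg (x≤y⇒0≤y-x x≤y) 0≤z) ⟩
    x * z + (y - x) * z  ≈⟨ distribʳ z x (y - x) ⟨
    (x + (y - x)) * z    ≈⟨ *-congʳ (+-comm x (y - x)) ⟩
    (y - x + x) * z      ≈⟨ *-congʳ (//-rightDividesˡ x y) ⟩
    y * z                ∎

  0<1 : 0# < 1#
  0<1 = Polyhedral.0≤1 ℝ , 0≉1

  1≰0 : ¬ (1# ≤ 0#)
  1≰0 = <⇒≱ 0<1

  -- The order axiom on products is non-strict. Strictness comes from the field: if the product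
  -- vanished, multiplying by the inverse of `x` would give `y ≈ 0#`.
  0<x*y : ∀ {x y} → 0# < x → 0# < y → 0# < x * y
  0<x*y {x} {y} 0<x 0<y = *-nonNeg (<⇒≤ 0<x) (<⇒≤ 0<y) , 0≉xy
    where
    0≉xy : ¬ (0# ≈ x * y)
    0≉xy 0≈xy with inverse x (λ x≈0 → proj₂ 0<x (sym x≈0))
    ... | u , xu≈1 = proj₂ 0<y (begin-equality
      0#          ≈⟨ zeroʳ u ⟨
      u * 0#      ≈⟨ *-congˡ 0≈xy ⟩
      u * (x * y) ≈⟨ *-assoc u x y ⟨
      u * x * y   ≈⟨ *-congʳ (trans (*-comm u x) xu≈1) ⟩
      1# * y      ≈⟨ *-identityˡ y ⟩
      y           ∎)

  positive-inverse : ∀ {x} → 0# < x → ∃[ u ] (0# < u × u * x ≈ 1#)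
  positive-inverse {x} 0<x with inverse x (λ x≈0 → proj₂ 0<x (sym x≈0))
  ... | u , xu≈1 = u , ≰⇒> u≰0 , trans (*-comm u x) xu≈1
    where
    u≰0 : ¬ (u ≤ 0#)
    u≰0 u≤0 = 1≰0 (begin
      1#                 ≤⟨ x≤x+y 1# (*-nonNeg (<⇒≤ 0<x) (x≤0⇒0≤-x u≤0)) ⟩
      1# + x * - u       ≈⟨ +-congˡ (-‿distribʳ-* x u) ⟨
      1# - x * u         ≈⟨ +-congˡ (-‿cong xu≈1) ⟩
      1# - 1#            ≈⟨ -‿inverseʳ 1# ⟩
      0#                 ∎)

  -- The witness is ε/(d + 1). The added 1 keeps the denominator positive when d = 0 and makes the
  -- inequality strict.
  scale-below : ∀ {d ε} → 0# ≤ d → 0# < ε → ∃[ δ ] (0# < δ × δ * d < ε)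
  scale-below {d} {ε} 0≤d 0<ε with positive-inverse (<-≤-trans 0<1 (≤-respʳ-≈ (+-comm 1# d) (x≤x+y 1# 0≤d)))
  ... | u , 0<u , u[d+1]≈1 = ε * u , 0<εu , (begin-strict
    ε * u * d             <⟨ x<x+y _ 0<εu ⟩
    ε * u * d + ε * u     ≈⟨ +-congˡ (*-identityʳ _) ⟨
    ε * u * d + ε * u * 1# ≈⟨ distribˡ (ε * u) d 1# ⟨
    ε * u * (d + 1#)      ≈⟨ *-assoc ε u _ ⟩
    ε * (u * (d + 1#))    ≈⟨ *-congˡ u[d+1]≈1 ⟩
    ε * 1#                ≈⟨ *-identityʳ ε ⟩
    ε                     ∎)
    where
    0<εu : 0# < ε * u
    0<εu = 0<x*y 0<ε 0<u

  halve : ∀ {ε} → 0# < ε → ∃[ δ ] (0# < δ × δ + δ ≤ ε)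
  halve {ε} 0<ε with scale-below (+-nonNeg (<⇒≤ 0<1) (<⇒≤ 0<1)) 0<ε
  ... | δ , 0<δ , δ2<ε = δ , 0<δ , (begin
    δ + δ               ≈⟨ +-cong (*-identityʳ δ) (*-identityʳ δ) ⟨
    δ * 1# + δ * 1#     ≈⟨ distribˡ δ 1# 1# ⟨
    δ * (1# + 1#)       <⟨ δ2<ε ⟩
    ε                   ∎)

  common-lower-bound : ∀ {x y} → 0# < x → 0# < y → ∃[ δ ] (0# < δ × δ ≤ x × δ ≤ y)
  common-lower-bound {x} {y} 0<x 0<y with total x y
  ... | inj₁ x≤y = x , 0<x , ≤-refl , x≤y
  ... | inj₂ y≤x = y , 0<y , y≤x , ≤-refl

  finite-lower-bound : ∀ {n} (f : Vector Carrier n) → (∀ i → 0# < f i) →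
                       ∃[ δ ] (0# < δ × (∀ i → δ ≤ f i))
  -- Any positive value does for the empty family, which occurs for the coordinates of `ℝ^ 0`.
  finite-lower-bound {zero}  f 0<f = 1# , 0<1 , λ ()
  finite-lower-bound {suc n} f 0<f with finite-lower-bound (λ i → f (suc i)) (λ i → 0<f (suc i))
  ... | δ , 0<δ , δ≤f with common-lower-bound (0<f zero) 0<δ
  ... | δ′ , 0<δ′ , δ′≤f₀ , δ′≤δ =
    δ′ , 0<δ′ , λ { zero → δ′≤f₀ ; (suc i) → ≤-trans δ′≤δ (δ≤f i) }

  sum-nonNeg : ∀ {n} (f : Vector Carrier n) → (∀ i → 0# ≤ f i) → 0# ≤ sum f
  sum-nonNeg {zero}  f 0≤f = ≤-refl
  sum-nonNeg {suc n} f 0≤f = +-nonNeg (0≤f zero) (sum-nonNeg _ (λ i → 0≤f (suc i)))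

  term≤sum : ∀ {n} (f : Vector Carrier n) → (∀ i → 0# ≤ f i) → ∀ i → f i ≤ sum f
  term≤sum {suc n} f 0≤f i =
    ≤-respʳ-≈ (sym (sum-remove {i = i} f)) (x≤x+y (f i) (sum-nonNeg (removeAt f i) (λ j → 0≤f (punchIn i j))))

-- Barycentric coordinates, hulls and cells of a simplex.

module Coordinates (ℝ : CompleteOrderedField) where

  open CompleteOrderedField ℝ hiding (zero)
  open RingProperties ring using (-1*x≈-x; x∙y⁻¹≈ε⇒x≈y; x≈y⇒x∙y⁻¹≈ε; //-rightDividesˡ)
  open SemiringSum semiring
    using (sum; sum-cong-≋; ∑-distrib-+; ∑-comm; *-distribˡ-sum; *-distribʳ-sum; sum-remove)
  open VecEquality setoid using (_≋_; ≋-sym; ≋-trans)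
  open OrderedField ℝ
  open Polyhedral ℝ
  open PosetReasoning poset

  combination-congˡ : ∀ {m n} {c d : Vector Carrier n} (v : Vector (ℝ^ m) n) →
                      c ≋ d → combination c v ≋ combination d v
  combination-congˡ v c≋d j = sum-cong-≋ (λ i → *-congʳ (c≋d i))

  combination-+ : ∀ {m n} (c d : Vector Carrier n) (v : Vector (ℝ^ m) n) →
                  ∀ j → combination (λ i → c i + d i) v j ≈ combination c v j + combination d v j
  combination-+ c d v j = trans (sum-cong-≋ (λ i → distribʳ (v i j) (c i) (d i)))
                                    (∑-distrib-+ (λ i → c i * v i j) (λ i → d i * v i j))

  combination-* : ∀ {m n} z (c : Vector Carrier n) (v : Vector (ℝ^ m) n) →
                  ∀ j → combination (λ i → z * c i) v j ≈ z * combination c v j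
  combination-* z c v j = trans (sum-cong-≋ (λ i → *-assoc z (c i) (v i j))) (sym (*-distribˡ-sum z (λ i → c i * v i j)))

  -- Change of vertices. The coefficient vectors `a l` are themselves points of `ℝ^ n`, so
  -- `combination d a` is a vector-matrix product giving the new coefficients.
  combination-assoc : ∀ {m n k} (d : Vector Carrier k) (a : Vector (ℝ^ n) k)
                      (w : Vector (ℝ^ m) k) (v : Vector (ℝ^ m) n) →
                      (∀ l → w l ≋ combination (a l) v) →
                      combination d w ≋ combination (combination d a) v
  combination-assoc d a w v w≋av j = begin-equality
    sum (λ l → d l * w l j)
      ≈⟨ sum-cong-≋ (λ l → trans (*-congˡ (w≋av l j)) (*-distribˡ-sum (d l) (λ i → a l i * v i j))) ⟩
    sum (λ l → sum (λ i → d l * (a l i * v i j)))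
      ≈⟨ ∑-comm (λ l i → d l * (a l i * v i j)) ⟩
    sum (λ i → sum (λ l → d l * (a l i * v i j)))
      ≈⟨ sum-cong-≋ (λ i → trans (sum-cong-≋ (λ l → sym (*-assoc (d l) (a l i) (v i j))))
                                 (sym (*-distribʳ-sum (v i j) (λ l → d l * a l i)))) ⟩
    sum (λ i → sum (λ l → d l * a l i) * v i j) ∎

  sum-combination : ∀ {n k} (d : Vector Carrier k) (a : Vector (ℝ^ n) k) →
                    (∀ l → sum (a l) ≈ 1#) → sum (combination d a) ≈ sum d
  sum-combination d a ∑a≈1 = begin-equality
    sum (λ i → sum (λ l → d l * a l i)) ≈⟨ ∑-comm (λ i l → d l * a l i) ⟩
    sum (λ l → sum (λ i → d l * a l i)) ≈⟨ sum-cong-≋ (λ l → sym (*-distribˡ-sum (d l) (a l))) ⟩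
    sum (λ l → d l * sum (a l))         ≈⟨ sum-cong-≋ (λ l → trans (*-congˡ (∑a≈1 l)) (*-identityʳ (d l))) ⟩
    sum d                               ∎

  combination-nonNeg : ∀ {n k} {d : Vector Carrier k} {a : Vector (ℝ^ n) k} →
                       (∀ l → 0# ≤ d l) → (∀ l i → 0# ≤ a l i) → ∀ i → 0# ≤ combination d a i
  combination-nonNeg 0≤d 0≤a i = sum-nonNeg _ (λ l → *-nonNeg (0≤d l) (0≤a l i))

  -- The Kronecker delta, serving as the barycentric coordinates of a vertex.
  basis : ∀ {n} → Fin n → Vector Carrier n
  basis zero    zero    = 1#
  basis zero    (suc j) = 0#
  basis (suc i) zero    = 0#
  basis (suc i) (suc j) = basis i j

  basis-nonNeg : ∀ {n} (i j : Fin n) → 0# ≤ basis i j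
  basis-nonNeg zero    zero    = 0≤1
  basis-nonNeg zero    (suc j) = ≤-refl
  basis-nonNeg (suc i) zero    = ≤-refl
  basis-nonNeg (suc i) (suc j) = basis-nonNeg i j

  basis-≢ : ∀ {n} (i j : Fin n) → ¬ (i ≡.≡ j) → basis i j ≈ 0#
  basis-≢ zero    zero    i≢j = contradiction ≡.refl i≢j
  basis-≢ zero    (suc j) i≢j = refl
  basis-≢ (suc i) zero    i≢j = refl
  basis-≢ (suc i) (suc j) i≢j = basis-≢ i j (λ i≡j → i≢j (≡.cong suc i≡j))

  sum-basis-* : ∀ {n} (i : Fin n) (f : Vector Carrier n) → sum (λ j → basis i j * f j) ≈ f i
  sum-basis-* {suc n} zero f = begin-equality
    1# * f zero + sum (λ j → 0# * f (suc j))
      ≈⟨ +-cong (*-identityˡ _) (trans (sym (*-distribˡ-sum 0# (λ j → f (suc j)))) (zeroˡ _)) ⟩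
    f zero + 0#
      ≈⟨ +-identityʳ _ ⟩
    f zero ∎
  sum-basis-* {suc n} (suc i) f =
    trans (+-cong (zeroˡ _) (sum-basis-* i (λ j → f (suc j)))) (+-identityˡ _)

  sum-basis : ∀ {n} (i : Fin n) → sum (basis i) ≈ 1#
  sum-basis i = trans (sum-cong-≋ (λ j → sym (*-identityʳ (basis i j)))) (sum-basis-* i (λ _ → 1#))

  coefficients-unique : ∀ {m n} (v : Vector (ℝ^ m) n) → AffinelyIndependent v →
                        ∀ {c d} → sum c ≈ sum d → combination c v ≋ combination d v → c ≋ d
  coefficients-unique v independent {c} {d} ∑c≈∑d cv≋dv i =
    x∙y⁻¹≈ε⇒x≈y (c i) (d i) (trans (+-congˡ (sym (-1*x≈-x (d i)))) (independent c-d ∑≈0 combination≈0 i))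
    where
    c-d : Vector Carrier _
    c-d i = c i + - 1# * d i

    ∑≈0 : sum c-d ≈ 0#
    ∑≈0 = begin-equality
      sum c-d                           ≈⟨ ∑-distrib-+ c _ ⟩
      sum c + sum (λ i → - 1# * d i)    ≈⟨ +-congˡ (*-distribˡ-sum (- 1#) d) ⟨
      sum c + - 1# * sum d              ≈⟨ +-congˡ (-1*x≈-x (sum d)) ⟩
      sum c - sum d                     ≈⟨ x≈y⇒x∙y⁻¹≈ε ∑c≈∑d ⟩
      0#                                ∎

    combination≈0 : combination c-d v ≋ (λ _ → 0#)
    combination≈0 j = begin-equality
      combination c-d v j
        ≈⟨ combination-+ c (λ i → - 1# * d i) v j ⟩
      combination c v j + combination (λ i → - 1# * d i) v j
        ≈⟨ +-congˡ (trans (combination-* (- 1#) d v j) (-1*x≈-x _)) ⟩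
      combination c v j - combination d v j
        ≈⟨ x≈y⇒x∙y⁻¹≈ε (cv≋dv j) ⟩
      0# ∎

  combination-remove : ∀ {m n} (c : Vector Carrier (suc n)) (v : Vector (ℝ^ m) (suc n)) i → c i ≈ 0# →
                       combination c v ≋ combination (removeAt c i) (removeAt v i)
  combination-remove c v i cᵢ≈0 j = begin-equality
    combination c v j                       ≈⟨ sum-remove {i = i} (λ l → c l * v l j) ⟩
    c i * v i j + rest                      ≈⟨ +-congʳ (trans (*-congʳ cᵢ≈0) (zeroˡ _)) ⟩
    0# + rest                               ≈⟨ +-identityˡ _ ⟩
    rest                                    ∎
    where rest = combination (removeAt c i) (removeAt v i) j

  sum-remove-zero : ∀ {n} (c : Vector Carrier (suc n)) i → c i ≈ 0# → sum c ≈ sum (removeAt c i)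
  sum-remove-zero c i cᵢ≈0 = trans (sum-remove {i = i} c) (trans (+-congʳ cᵢ≈0) (+-identityˡ _))

  -- A relation among the remaining vertices becomes a relation among all of them when the
  -- coefficient 0 is inserted at `i`.
  removeAt-independent : ∀ {m n} (v : Vector (ℝ^ m) (suc n)) i →
                         AffinelyIndependent v → AffinelyIndependent (removeAt v i)
  removeAt-independent v i independent c ∑c≈0 cv≋0 j =
    trans (sym (c⁺∘punchIn j)) (independent c⁺ ∑c⁺≈0 c⁺v≋0 (punchIn i j))
    where
    c⁺ : Vector Carrier _
    c⁺ = insertAt c i 0#

    c⁺ᵢ≈0 : c⁺ i ≈ 0#
    c⁺ᵢ≈0 = reflexive (insertAt-lookup c i 0#)

    c⁺∘punchIn : removeAt c⁺ i ≋ c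
    c⁺∘punchIn j = reflexive (insertAt-punchIn c i 0# j)

    ∑c⁺≈0 : sum c⁺ ≈ 0#
    ∑c⁺≈0 = trans (sum-remove-zero c⁺ i c⁺ᵢ≈0) (trans (sum-cong-≋ c⁺∘punchIn) ∑c≈0)

    c⁺v≋0 : combination c⁺ v ≋ (λ _ → 0#)
    c⁺v≋0 = ≋-trans (combination-remove c⁺ v i c⁺ᵢ≈0)
                    (≋-trans (combination-congˡ (removeAt v i) c⁺∘punchIn) cv≋0)

  hull-resp-≋ : ∀ {m} (σ : Simplex m) {x y} → x ≋ y → x ∈ hull σ → y ∈ hull σ
  hull-resp-≋ σ x≋y (c , 0≤c , ∑c≈1 , x≋cv) = c , 0≤c , ∑c≈1 , ≋-trans (≋-sym x≋y) x≋cv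

  cell-resp-≋ : ∀ {m} (σ : Simplex m) {x y} → x ≋ y → x ∈ cell σ → y ∈ cell σ
  cell-resp-≋ σ x≋y (c , 0<c , ∑c≈1 , x≋cv) = c , 0<c , ∑c≈1 , ≋-trans (≋-sym x≋y) x≋cv

  cell⊆hull : ∀ {m} (σ : Simplex m) → cell σ ⊆ hull σ
  cell⊆hull σ (c , 0<c≤1 , ∑c≈1 , x≋cv) = c , (λ i → <⇒≤ (proj₁ (0<c≤1 i))) , ∑c≈1 , x≋cv

  -- The bound `c i ≤ 1#` in `cell` is automatic, since a term of a nonnegative sum is at most the
  -- sum.
  positive-combination∈cell : ∀ {m} (σ : Simplex m) c → (∀ i → 0# < c i) → sum c ≈ 1# →
                              combination c (vertex σ) ∈ cell σ
  positive-combination∈cell σ c 0<c ∑c≈1 =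
    c , (λ i → 0<c i , ≤-respʳ-≈ ∑c≈1 (term≤sum c (λ i → <⇒≤ (0<c i)) i)) , ∑c≈1 , λ _ → refl

  vertex∈hull : ∀ {m} (σ : Simplex m) i → vertex σ i ∈ hull σ
  vertex∈hull σ i =
    basis i , basis-nonNeg i , sum-basis i , λ j → sym (sum-basis-* i (λ l → vertex σ l j))

  hull⊆ : ∀ {m} (σ τ : Simplex m) → (∀ i → vertex σ i ∈ hull τ) → hull σ ⊆ hull τ
  hull⊆ σ τ vertex∈τ (c , 0≤c , ∑c≈1 , x≋cv) =
    combination c a ,
    combination-nonNeg 0≤c (λ i → proj₁ (proj₂ (vertex∈τ i))) ,
    trans (sum-combination c a (λ i → proj₁ (proj₂ (proj₂ (vertex∈τ i))))) ∑c≈1 ,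
    ≋-trans x≋cv (combination-assoc c a (vertex σ) (vertex τ) (λ i → proj₂ (proj₂ (proj₂ (vertex∈τ i)))))
    where
    a : Vector (Vector Carrier _) _
    a i = proj₁ (vertex∈τ i)

  face⇒hull⊆ : ∀ {m} (τ σ : Simplex m) → IsFace τ σ → hull τ ⊆ hull σ
  face⇒hull⊆ τ σ face = hull⊆ τ σ λ i →
    hull-resp-≋ σ (≋-sym (proj₂ (face i))) (vertex∈hull σ (proj₁ (face i)))

  -- Writing v and w for the vertices of σ and τ, take t > 0 so small that
  -- x = ∑ᵢ cᵢ vᵢ minus t ∑ⱼ wⱼ still has nonnegative coordinates e in v.
  -- Rewritten in terms of w, the point x = ∑ᵢ eᵢ vᵢ + ∑ⱼ t wⱼ has all its coordinates ≥ t.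
  hull≐⇒cell⊆ : ∀ {m} (σ τ : Simplex m) → hull σ ≐ hull τ → cell σ ⊆ cell τ
  hull≐⇒cell⊆ {m} σ τ (σ⊆τ , τ⊆σ) {x} (c , 0<c≤1 , ∑c≈1 , x≋cv) =
    cell-resp-≋ τ fw≋x (positive-combination∈cell τ f 0<f ∑f≈1)
    where
    v : Vector (ℝ^ m) _
    v = vertex σ

    w : Vector (ℝ^ m) _
    w = vertex τ

    v∈τ : ∀ i → v i ∈ hull τ
    v∈τ i = σ⊆τ (vertex∈hull σ i)

    w∈σ : ∀ j → w j ∈ hull σ
    w∈σ j = τ⊆σ (vertex∈hull τ j)

    a : Vector (Vector Carrier _) _
    a i = proj₁ (v∈τ i)

    g : Vector (Vector Carrier _) _
    g j = proj₁ (w∈σ j)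

    g-nonNeg : ∀ j i → 0# ≤ g j i
    g-nonNeg j = proj₁ (proj₂ (w∈σ j))

    G : Vector Carrier _
    G i = sum (λ j → g j i)

    small : ∀ i → ∃[ δ ] (0# < δ × δ * G i < c i)
    small i = scale-below (sum-nonNeg _ (λ j → g-nonNeg j i)) (proj₁ (0<c≤1 i))

    minimum : ∃[ t ] (0# < t × (∀ i → t ≤ proj₁ (small i)))
    minimum = finite-lower-bound (λ i → proj₁ (small i)) (λ i → proj₁ (proj₂ (small i)))

    t : Carrier
    t = proj₁ minimum

    T : Vector Carrier _
    T = replicate _ t

    tw : Vector Carrier _
    tw = combination T g

    tw≤c : ∀ i → tw i ≤ c i
    tw≤c i = begin
      tw i                     ≈⟨ *-distribˡ-sum t (λ j → g j i) ⟨
      t * G i                  ≤⟨ *-monoˡ-≤-nonNeg (sum-nonNeg _ (λ j → g-nonNeg j i)) (proj₂ (proj₂ minimum) i) ⟩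
      proj₁ (small i) * G i    <⟨ proj₂ (proj₂ (small i)) ⟩
      c i                      ∎

    e : Vector Carrier _
    e i = c i - tw i

    e+tw≋c : (λ i → e i + tw i) ≋ c
    e+tw≋c i = //-rightDividesˡ (tw i) (c i)

    f : Vector Carrier _
    f j = t + combination e a j

    0<f : ∀ j → 0# < f j
    0<f j = +-pos-nonNeg (proj₁ (proj₂ minimum))
      (combination-nonNeg (λ i → x≤y⇒0≤y-x (tw≤c i)) (λ i → proj₁ (proj₂ (v∈τ i))) j)

    ∑f≈1 : sum f ≈ 1#
    ∑f≈1 = begin-equality
      sum f                             ≈⟨ ∑-distrib-+ T (combination e a) ⟩
      sum T + sum (combination e a)     ≈⟨ +-cong (sym (sum-combination T g (λ j → proj₁ (proj₂ (proj₂ (w∈σ j))))))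
                                                  (sum-combination e a (λ i → proj₁ (proj₂ (proj₂ (v∈τ i))))) ⟩
      sum tw + sum e                    ≈⟨ +-comm _ _ ⟩
      sum e + sum tw                    ≈⟨ ∑-distrib-+ e tw ⟨
      sum (λ i → e i + tw i)            ≈⟨ sum-cong-≋ e+tw≋c ⟩
      sum c                             ≈⟨ ∑c≈1 ⟩
      1#                                ∎

    fw≋x : combination f w ≋ x
    fw≋x j = begin-equality
      combination f w j
        ≈⟨ combination-+ T (combination e a) w j ⟩
      combination T w j + combination (combination e a) w j
        ≈⟨ +-cong (combination-assoc T g w v (λ l → proj₂ (proj₂ (proj₂ (w∈σ l)))) j)
                  (sym (combination-assoc e a v w (λ i → proj₂ (proj₂ (proj₂ (v∈τ i)))) j)) ⟩
      combination tw v j + combination e v j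
        ≈⟨ +-comm _ _ ⟩
      combination e v j + combination tw v j
        ≈⟨ combination-+ e tw v j ⟨
      combination (λ i → e i + tw i) v j
        ≈⟨ combination-congˡ v e+tw≋c j ⟩
      combination c v j
        ≈⟨ x≋cv j ⟨
      x j ∎

-- The cells cover the polyhedron, and cells that meet coincide.

module Cells (em : ExcludedMiddle 0ℓ) (ℝ : CompleteOrderedField) where

  open CompleteOrderedField ℝ hiding (zero)
  open SemiringSum semiring using (sum; sum-cong-≋; sum-replicate-zero)
  open VecEquality setoid using (_≋_; ≋-sym; ≋-trans)
  open OrderedField ℝ
  open Coordinates ℝ
  open Polyhedral ℝ

  -- Vertices with coefficient 0 are discarded one at a time, by induction on the dimension. When
  -- none is left to discard, the point is in the cell of the face spanned by the rest.
  positive-face : ∀ {m} n (v : Vector (ℝ^ m) (suc n)) → AffinelyIndependent v →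
                  ∀ {x} c → (∀ i → 0# ≤ c i) → sum c ≈ 1# → x ≋ combination c v →
                  ∃[ τ ] ((∀ i → ∃[ j ] vertex τ i ≋ v j) × x ∈ cell τ)
  positive-face n v independent c 0≤c ∑c≈1 x≋cv with any? (λ i → em {c i ≈ 0#})
  ... | no c≉0 =
    τ , (λ i → i , λ _ → refl) ,
    cell-resp-≋ τ (≋-sym x≋cv)
      (positive-combination∈cell τ c (λ i → 0≤c i , λ 0≈cᵢ → c≉0 (i , sym 0≈cᵢ)) ∑c≈1)
    where
    τ : Simplex _
    τ = record { dim = n ; vertex = v ; independent = independent }
  -- The last vertex cannot be discarded: the coefficients would sum to 0.
  positive-face zero    v _           c _   ∑c≈1 _    | yes (i , cᵢ≈0) =
    contradiction (trans (sym (sum-remove-zero c i cᵢ≈0)) ∑c≈1) 0≉1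
  positive-face (suc n) v independent c 0≤c ∑c≈1 x≋cv | yes (i , cᵢ≈0)
    with positive-face n (removeAt v i) (removeAt-independent v i independent) (removeAt c i)
           (λ j → 0≤c (punchIn i j))
           (trans (sym (sum-remove-zero c i cᵢ≈0)) ∑c≈1)
           (≋-trans x≋cv (combination-remove c v i cᵢ≈0))
  ... | τ , face , x∈τ = τ , (λ j → punchIn i (proj₁ (face j)) , proj₂ (face j)) , x∈τ

  -- A point of ρ has coordinate 0 at each vertex of σ outside ρ. By uniqueness of coordinates these
  -- are the positive ones given by the cell of σ, so no vertex lies outside ρ.
  face-through-cell : ∀ {m} (σ ρ : Simplex m) → IsFace ρ σ →
                      ∀ {x} → x ∈ cell σ → x ∈ hull ρ → hull σ ⊆ hull ρ
  face-through-cell σ ρ face {x} (c , 0<c≤1 , ∑c≈1 , x≋cv) (d , 0≤d , ∑d≈1 , x≋dw) =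
    hull⊆ σ ρ vertex∈ρ
    where
    a : Vector (Vector Carrier _) _
    a l = basis (proj₁ (face l))

    w≋av : ∀ l → vertex ρ l ≋ combination (a l) (vertex σ)
    w≋av l j = trans (proj₂ (face l) j) (sym (sum-basis-* (proj₁ (face l)) (λ i → vertex σ i j)))

    c≋da : c ≋ combination d a
    c≋da = coefficients-unique (vertex σ) (independent σ)
      (trans ∑c≈1 (sym (trans (sum-combination d a (λ l → sum-basis (proj₁ (face l)))) ∑d≈1)))
      (≋-trans (≋-sym x≋cv) (≋-trans x≋dw (combination-assoc d a (vertex ρ) (vertex σ) w≋av)))

    vertex∈ρ : ∀ i → vertex σ i ∈ hull ρ
    vertex∈ρ i with any? (λ l → proj₁ (face l) ≟ i)
    ... | yes (l , ≡.refl) = hull-resp-≋ ρ (proj₂ (face l)) (vertex∈hull ρ l)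
    ... | no ∄l = contradiction (sym cᵢ≈0) (proj₂ (proj₁ (0<c≤1 i)))
      where
      cᵢ≈0 : c i ≈ 0#
      cᵢ≈0 = trans (c≋da i) (trans
        (sum-cong-≋ (λ l → trans (*-congˡ (basis-≢ (proj₁ (face l)) i (λ f≡i → ∄l (l , f≡i)))) (zeroʳ (d l))))
        (sum-replicate-zero (suc (dim ρ))))

  module _ {m} (K : SimplicialComplex m) where

    hull⇒some-cell : ∀ {x σ} → σ ∈ᴸ simplices K → x ∈ hull σ → Any (λ ρ → x ∈ cell ρ) (simplices K)
    hull⇒some-cell {x} {σ} σ∈K (c , 0≤c , ∑c≈1 , x≋cv)
      with positive-face (dim σ) (vertex σ) (independent σ) c 0≤c ∑c≈1 x≋cv
    ... | τ , face , x∈τ =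
      map (λ {ρ} ρ≐τ → hull≐⇒cell⊆ τ ρ (swap ρ≐τ) x∈τ) (face-closed K σ∈K τ face)

    opaque

      point∈some-cell : ∀ (x : Point K) → ∃[ σ ] (σ ∈ᴸ simplices K × proj₁ x ∈ cell σ)
      point∈some-cell (x , x∈K) with find x∈K
      ... | σ , σ∈K , x∈σ = find (hull⇒some-cell σ∈K x∈σ)

    -- The common face ρ contains a point of both cells, hence is all of σ and all of τ. So σ and τ
    -- have the same hull, which determines the cell.
    meeting-cells : ∀ {σ τ} → σ ∈ᴸ simplices K → τ ∈ᴸ simplices K →
                    ∀ {x} → x ∈ cell σ → x ∈ cell τ → cell σ ⊆ cell τ
    meeting-cells {σ} {τ} σ∈K τ∈K {x} x∈σ x∈τ with meet K σ∈K τ∈K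
    ... | inj₁ disjoint = contradiction (cell⊆hull σ x∈σ , cell⊆hull τ x∈τ) (disjoint x)
    ... | inj₂ (ρ , ρ≤σ , ρ≤τ , σ∩τ⊆ρ , _) =
      hull≐⇒cell⊆ σ τ
        ( (λ y∈σ → face⇒hull⊆ ρ τ ρ≤τ (face-through-cell σ ρ ρ≤σ x∈σ x∈ρ y∈σ))
        , (λ y∈τ → face⇒hull⊆ ρ σ ρ≤σ (face-through-cell τ ρ ρ≤τ x∈τ x∈ρ y∈τ)) )
      where
      x∈ρ : x ∈ hull ρ
      x∈ρ = σ∩τ⊆ρ (cell⊆hull σ x∈σ , cell⊆hull τ x∈τ)

-- Continuity estimates, segments in cells and concatenation of paths.

module Paths (ℝ : CompleteOrderedField) where

  open CompleteOrderedField ℝ hiding (zero)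
  open RingProperties ring
    using (-‿distribˡ-*; -‿distribʳ-*; x[y-z]≈xy-xz; //-rightDividesˡ; //-rightDividesʳ; -‿involutive; xyx⁻¹≈y)
  open CommutativeSemigroupProperties +-commutativeSemigroup using (interchange)
  open SemiringSum semiring using (sum; ∑-distrib-+; *-distribˡ-sum)
  open VecEquality setoid using (_≋_; ≋-sym; ≋-trans)
  open OrderedField ℝ
  open Coordinates ℝ
  open Polyhedral ℝ
  open Min totalOrder
  open Max totalOrder
  open PosetReasoning poset

  Near-weaken : ∀ {δ ε x y} → δ ≤ ε → Near δ x y → Near ε x y
  Near-weaken δ≤ε (x<y+δ , y<x+δ) =
    <-≤-trans x<y+δ (+-monoʳ-≤ _ δ≤ε) , <-≤-trans y<x+δ (+-monoʳ-≤ _ δ≤ε)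

  Near-+ : ∀ {δ ε x y u v} → Near δ x y → Near ε u v → Near (δ + ε) (x + u) (y + v)
  Near-+ (x<y+δ , y<x+δ) (u<v+ε , v<u+ε) = add x<y+δ u<v+ε , add y<x+δ v<u+ε
    where
    add : ∀ {δ ε x y u v} → x < y + δ → u < v + ε → x + u < y + v + (δ + ε)
    add {δ} {ε} {x} {y} {u} {v} x<y+δ u<v+ε = begin-strict
      x + u               <⟨ +-mono-< x<y+δ u<v+ε ⟩
      y + δ + (v + ε)     ≈⟨ interchange y δ v ε ⟩
      y + v + (δ + ε)     ∎

  +-near : ∀ {δ x y} z → Near δ x y → Near δ (x + z) (y + z)
  +-near z (x<y+δ , y<x+δ) = add x<y+δ , add y<x+δ
    where
    add : ∀ {δ x y} → x < y + δ → x + z < y + z + δ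
    add {δ} {x} {y} x<y+δ = begin-strict
      x + z       <⟨ +-monoˡ-< z x<y+δ ⟩
      y + δ + z   ≈⟨ +-assoc y δ z ⟩
      y + (δ + z) ≈⟨ +-congˡ (+-comm δ z) ⟩
      y + (z + δ) ≈⟨ +-assoc y z δ ⟨
      y + z + δ   ∎

  Near-neg : ∀ {δ x y} → Near δ x y → Near δ (- x) (- y)
  Near-neg (x<y+δ , y<x+δ) = flip y<x+δ , flip x<y+δ
    where
    flip : ∀ {δ x y} → y < x + δ → - x < - y + δ
    flip {δ} {x} {y} y<x+δ = begin-strict
      - x                       ≈⟨ //-rightDividesˡ y (- x) ⟨
      - x - y + y               ≈⟨ +-comm _ y ⟩
      y + (- x - y)             <⟨ +-monoˡ-< (- x - y) y<x+δ ⟩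
      x + δ + (- x - y)         ≈⟨ interchange x δ (- x) (- y) ⟩
      x - x + (δ - y)           ≈⟨ +-cong (-‿inverseʳ x) (+-comm δ (- y)) ⟩
      0# + (- y + δ)            ≈⟨ +-identityˡ _ ⟩
      - y + δ                   ∎

  Near-cong : ∀ {ε x x′ y y′} → x ≈ x′ → y ≈ y′ → Near ε x y → Near ε x′ y′
  Near-cong {ε} {x} {x′} {y} {y′} x≈x′ y≈y′ (x<y+ε , y<x+ε) =
    (begin-strict x′ ≈⟨ x≈x′ ⟨ x <⟨ x<y+ε ⟩ y + ε ≈⟨ +-congʳ y≈y′ ⟩ y′ + ε ∎) ,
    (begin-strict y′ ≈⟨ y≈y′ ⟨ y <⟨ y<x+ε ⟩ x + ε ≈⟨ +-congʳ x≈x′ ⟩ x′ + ε ∎)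

  Near-⊓ : ∀ {ε x y} z → 0# < ε → Near ε x y → Near ε (x ⊓ z) (y ⊓ z)
  Near-⊓ z 0<ε (x<y+ε , y<x+ε) = bound x<y+ε , bound y<x+ε
    where
    bound : ∀ {x y} → x < y + _ → x ⊓ z < y ⊓ z + _
    bound {x} {y} x<y+ε with ⊓-sel y z
    ... | inj₁ y⊓z≈y = begin-strict
      x ⊓ z     ≤⟨ x⊓y≤x x z ⟩
      x         <⟨ x<y+ε ⟩
      y + _     ≈⟨ +-congʳ y⊓z≈y ⟨
      y ⊓ z + _ ∎
    ... | inj₂ y⊓z≈z = begin-strict
      x ⊓ z     ≤⟨ x⊓y≤y x z ⟩
      z         <⟨ x<x+y z 0<ε ⟩
      z + _     ≈⟨ +-congʳ y⊓z≈z ⟨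
      y ⊓ z + _ ∎

  Near-⊔ : ∀ {ε x y} z → 0# < ε → Near ε x y → Near ε (x ⊔ z) (y ⊔ z)
  Near-⊔ z 0<ε (x<y+ε , y<x+ε) = bound x<y+ε , bound y<x+ε
    where
    bound : ∀ {x y} → x < y + _ → x ⊔ z < y ⊔ z + _
    bound {x} {y} x<y+ε with ⊔-sel x z
    ... | inj₁ x⊔z≈x = begin-strict
      x ⊔ z     ≈⟨ x⊔z≈x ⟩
      x         <⟨ x<y+ε ⟩
      y + _     ≤⟨ +-monoˡ-≤ _ (x≤x⊔y y z) ⟩
      y ⊔ z + _ ∎
    ... | inj₂ x⊔z≈z = begin-strict
      x ⊔ z     ≈⟨ x⊔z≈z ⟩
      z         ≤⟨ x≤y⊔x y z ⟩
      y ⊔ z     <⟨ x<x+y _ 0<ε ⟩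
      y ⊔ z + _ ∎

  scaling-continuous-nonNeg : ∀ {d ε} → 0# ≤ d → 0# < ε →
                              ∃[ δ ] (0# < δ × (∀ {r s} → Near δ r s → Near ε (r * d) (s * d)))
  scaling-continuous-nonNeg {d} {ε} 0≤d 0<ε with scale-below 0≤d 0<ε
  ... | δ , 0<δ , δd<ε = δ , 0<δ , λ (r<s+δ , s<r+δ) → bound r<s+δ , bound s<r+δ
    where
    bound : ∀ {r s} → r < s + δ → r * d < s * d + ε
    bound {r} {s} r<s+δ = begin-strict
      r * d           ≤⟨ *-monoˡ-≤-nonNeg 0≤d (<⇒≤ r<s+δ) ⟩
      (s + δ) * d     ≈⟨ distribʳ d s δ ⟩
      s * d + δ * d   ≈⟨ +-comm _ _ ⟩
      δ * d + s * d   <⟨ +-monoˡ-< (s * d) δd<ε ⟩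
      ε + s * d       ≈⟨ +-comm _ _ ⟩
      s * d + ε       ∎

  -- `Near` consists of two one-sided inequalities that negation exchanges, so a negative factor
  -- reduces to its opposite.
  scaling-continuous : ∀ d {ε} → 0# < ε →
                       ∃[ δ ] (0# < δ × (∀ {r s} → Near δ r s → Near ε (r * d) (s * d)))
  scaling-continuous d 0<ε with total 0# d
  ... | inj₁ 0≤d = scaling-continuous-nonNeg 0≤d 0<ε
  ... | inj₂ d≤0 with scaling-continuous-nonNeg (x≤0⇒0≤-x d≤0) 0<ε
  ...   | δ , 0<δ , near = δ , 0<δ , λ {r} {s} r~s →
    Near-cong (-[r*-d]≈r*d r) (-[r*-d]≈r*d s) (Near-neg (near r~s))
    where
    -[r*-d]≈r*d : ∀ r → - (r * - d) ≈ r * d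
    -[r*-d]≈r*d r = trans (-‿distribʳ-* r (- d)) (*-congˡ (-‿involutive d))

  segment : ∀ {m} → ℝ^ m → ℝ^ m → Carrier → ℝ^ m
  segment x y r j = r * (y j - x j) + x j

  segment-cong : ∀ {m} (x y : ℝ^ m) {r s} → r ≈ s → segment x y r ≋ segment x y s
  segment-cong x y r≈s j = +-congʳ (*-congʳ r≈s)

  segment-0 : ∀ {m} (x y : ℝ^ m) → segment x y 0# ≋ x
  segment-0 x y j = trans (+-congʳ (zeroˡ _)) (+-identityˡ (x j))

  segment-1 : ∀ {m} (x y : ℝ^ m) → segment x y 1# ≋ y
  segment-1 x y j = trans (+-congʳ (*-identityˡ _)) (//-rightDividesˡ (x j) (y j))

  -- The left form, a scaling followed by a translation, suits continuity in `r`; the right form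
  -- exhibits the convex weights.
  segment-affine : ∀ r x y → r * (y - x) + x ≈ (1# - r) * x + r * y
  segment-affine r x y = begin-equality
    r * (y - x) + x             ≈⟨ +-congʳ (x[y-z]≈xy-xz r y x) ⟩
    r * y - r * x + x           ≈⟨ +-assoc (r * y) _ x ⟩
    r * y + (- (r * x) + x)     ≈⟨ +-comm (r * y) _ ⟩
    - (r * x) + x + r * y       ≈⟨ +-congʳ (+-comm _ x) ⟩
    x - r * x + r * y           ≈⟨ +-congʳ (+-cong (*-identityˡ x) (sym (-‿distribˡ-* r x))) ⟨
    1# * x + - r * x + r * y    ≈⟨ +-congʳ (distribʳ x 1# (- r)) ⟨
    (1# - r) * x + r * y        ∎

  cell-convex : ∀ {m} (σ : Simplex m) {x y} → x ∈ cell σ → y ∈ cell σ →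
                ∀ r → 0# ≤ r → r ≤ 1# → segment x y r ∈ cell σ
  cell-convex σ {x} {y} (c , 0<c≤1 , ∑c≈1 , x≋cv) (d , 0<d≤1 , ∑d≈1 , y≋dv) r 0≤r r≤1 =
    cell-resp-≋ σ ev≋segment (positive-combination∈cell σ e 0<e ∑e≈1)
    where
    e : Vector Carrier _
    e i = (1# - r) * c i + r * d i

    1-r+r≈1 : 1# - r + r ≈ 1#
    1-r+r≈1 = //-rightDividesˡ r 1#

    0<e : ∀ i → 0# < e i
    -- Either weight may vanish at an end of the segment. A weighted mean of `c i` and `d i` is
    -- nevertheless at least any common lower bound of them.
    0<e i with common-lower-bound (proj₁ (0<c≤1 i)) (proj₁ (0<d≤1 i))
    ... | δ , 0<δ , δ≤cᵢ , δ≤dᵢ = begin-strict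
      0#                        <⟨ 0<δ ⟩
      δ                         ≈⟨ *-identityʳ δ ⟨
      δ * 1#                    ≈⟨ *-congˡ 1-r+r≈1 ⟨
      δ * (1# - r + r)          ≈⟨ distribˡ δ (1# - r) r ⟩
      δ * (1# - r) + δ * r      ≤⟨ +-mono-≤ (*-monoˡ-≤-nonNeg (x≤y⇒0≤y-x r≤1) δ≤cᵢ) (*-monoˡ-≤-nonNeg 0≤r δ≤dᵢ) ⟩
      c i * (1# - r) + d i * r  ≈⟨ +-cong (*-comm _ _) (*-comm _ _) ⟩
      e i                       ∎

    ∑e≈1 : sum e ≈ 1#
    ∑e≈1 = begin-equality
      sum e
        ≈⟨ ∑-distrib-+ (λ i → (1# - r) * c i) (λ i → r * d i) ⟩
      sum (λ i → (1# - r) * c i) + sum (λ i → r * d i)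
        ≈⟨ +-cong (*-distribˡ-sum (1# - r) c) (*-distribˡ-sum r d) ⟨
      (1# - r) * sum c + r * sum d
        ≈⟨ +-cong (*-congˡ ∑c≈1) (*-congˡ ∑d≈1) ⟩
      (1# - r) * 1# + r * 1#
        ≈⟨ +-cong (*-identityʳ _) (*-identityʳ r) ⟩
      1# - r + r
        ≈⟨ 1-r+r≈1 ⟩
      1# ∎

    ev≋segment : combination e (vertex σ) ≋ segment x y r
    ev≋segment j = begin-equality
      combination e (vertex σ) j
        ≈⟨ combination-+ (λ i → (1# - r) * c i) (λ i → r * d i) (vertex σ) j ⟩
      combination (λ i → (1# - r) * c i) (vertex σ) j + combination (λ i → r * d i) (vertex σ) j
        ≈⟨ +-cong (combination-* (1# - r) c (vertex σ) j) (combination-* r d (vertex σ) j) ⟩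
      (1# - r) * combination c (vertex σ) j + r * combination d (vertex σ) j
        ≈⟨ +-cong (*-congˡ (x≋cv j)) (*-congˡ (y≋dv j)) ⟨
      (1# - r) * x j + r * y j
        ≈⟨ segment-affine r (x j) (y j) ⟨
      segment x y r j ∎

  -- A concatenation α · β traverses α on [0,1/2] at parameter firstHalf r = min(2r,1)
  -- and β on [1/2,1] at parameter secondHalf r = max(2r-1,0).
  firstHalf : UnitInterval → UnitInterval
  firstHalf (r , 0≤r , _) = (r + r) ⊓ 1# , ⊓-glb (+-nonNeg 0≤r 0≤r) 0≤1 , x⊓y≤y _ _

  2r-1≤r : ∀ {r} → r ≤ 1# → r + r - 1# ≤ r
  2r-1≤r {r} r≤1 = begin
    r + r - 1#    ≤⟨ +-monoˡ-≤ (- 1#) (+-monoʳ-≤ r r≤1) ⟩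
    r + 1# - 1#   ≈⟨ //-rightDividesʳ 1# r ⟩
    r             ∎

  secondHalf : UnitInterval → UnitInterval
  secondHalf (r , _ , r≤1) = (r + r - 1#) ⊔ 0# , x≤y⊔x _ 0# , ⊔-lub (≤-trans (2r-1≤r r≤1) r≤1) 0≤1

  -- Since η constrains a path only before parameter 1, times before the end of the concatenation
  -- must correspond to times before the end of its second path.
  secondHalf-<1 : ∀ r → r <1 → secondHalf r <1
  secondHalf-<1 (r , 0≤r , r≤1) r<1 = begin-strict
    (r + r - 1#) ⊔ 0#   ≤⟨ ⊔-lub (2r-1≤r r≤1) 0≤r ⟩
    r                   <⟨ r<1 ⟩
    1#                  ∎

  firstHalf-or-secondHalf : ∀ r → proj₁ (secondHalf r) ≈ 0# ⊎ proj₁ (firstHalf r) ≈ 1#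
  firstHalf-or-secondHalf (r , _) = Sum.map 2r≤1⇒ x≤y⇒y⊓x≈x (total (r + r) 1#)
    where
    2r≤1⇒ : r + r ≤ 1# → (r + r - 1#) ⊔ 0# ≈ 0#
    2r≤1⇒ 2r≤1 = x≤y⇒x⊔y≈y (≤-respʳ-≈ (-‿inverseʳ 1#) (+-monoˡ-≤ (- 1#) 2r≤1))

  module _ {m} {K : SimplicialComplex m} where

    point-resp-≋ : ∀ (x : Point K) {y : ℝ^ m} → proj₁ x ≋ y → Any (λ σ → y ∈ hull σ) (simplices K)
    point-resp-≋ x x≋y = map (λ {σ} → hull-resp-≋ σ x≋y) (proj₂ x)

    constant : Point K → Path K
    constant x = record
      { func = record { to = λ _ → x ; cong = λ _ _ → refl }
      ; continuous = λ r ε 0<ε → ε , 0<ε , λ s _ j → x<x+y _ 0<ε , x<x+y _ 0<ε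
      }

    cell-segment : ∀ {σ} → σ ∈ᴸ simplices K → (x y : Point K) → proj₁ x ∈ cell σ → proj₁ y ∈ cell σ → Path K
    cell-segment {σ} σ∈K (x , _) (y , _) x∈σ y∈σ = record
      { func = record
        { to = λ (r , 0≤r , r≤1) → segment x y r , lose σ∈K (cell⊆hull σ (cell-convex σ x∈σ y∈σ r 0≤r r≤1))
        ; cong = segment-cong x y
        }
      ; continuous = continuous
      }
      where
      continuous : ∀ r ε → 0# < ε → ∃[ δ ] (0# < δ × (∀ s → Near δ (proj₁ r) (proj₁ s) →
                   ∀ j → Near ε (segment x y (proj₁ r) j) (segment x y (proj₁ s) j)))
      continuous r ε 0<ε = δ , proj₁ (proj₂ minimum) , λ s r~s j →
        +-near (x j) (proj₂ (proj₂ (δs j)) (Near-weaken (proj₂ (proj₂ minimum) j) r~s))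
        where
        δs : ∀ j → ∃[ δ ] (0# < δ × (∀ {r s} → Near δ r s → Near ε (r * (y j - x j)) (s * (y j - x j))))
        δs j = scaling-continuous (y j - x j) 0<ε

        minimum : ∃[ δ ] (0# < δ × (∀ j → δ ≤ proj₁ (δs j)))
        minimum = finite-lower-bound (λ j → proj₁ (δs j)) (λ j → proj₁ (proj₂ (δs j)))

        δ : Carrier
        δ = proj₁ minimum

    module Concatenation (α β : Path K) (α₁≈β₀ : proj₁ (at α 1ᴵ) ≋ proj₁ (at β 0ᴵ)) where

      private
        module α = Path α
        module β = Path β

      -- At each time one of the two paths stands still: either β is at its start and the difference
      -- vanishes, or α is at its end and cancels β's start. As a sum, the concatenation is
      -- continuous and respects equality without a case distinction or gluing at 1/2.
      point : UnitInterval → ℝ^ m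
      point r j = proj₁ (α.at (firstHalf r)) j + (proj₁ (β.at (secondHalf r)) j - proj₁ (β.at 0ᴵ) j)

      point≋α : ∀ r → proj₁ (secondHalf r) ≈ 0# → point r ≋ proj₁ (α.at (firstHalf r))
      point≋α r secondHalf≈0 j = trans
        (+-congˡ (trans (+-congʳ (β.at-cong secondHalf≈0 j)) (-‿inverseʳ _)))
        (+-identityʳ _)

      point≋β : ∀ r → proj₁ (firstHalf r) ≈ 1# → point r ≋ proj₁ (β.at (secondHalf r))
      point≋β r firstHalf≈1 j = trans
        (+-congʳ (trans (α.at-cong {y = 1ᴵ} firstHalf≈1 j) (α₁≈β₀ j)))
        (trans (sym (+-assoc _ _ _)) (xyx⁻¹≈y _ _))

      point∈K : ∀ r → Any (λ σ → point r ∈ hull σ) (simplices K)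
      point∈K r with firstHalf-or-secondHalf r
      ... | inj₁ secondHalf≈0 = point-resp-≋ (α.at (firstHalf r)) (≋-sym (point≋α r secondHalf≈0))
      ... | inj₂ firstHalf≈1  = point-resp-≋ (β.at (secondHalf r)) (≋-sym (point≋β r firstHalf≈1))

      point-cong : ∀ {r s} → proj₁ r ≈ proj₁ s → point r ≋ point s
      point-cong r≈s j = +-cong
        (α.at-cong (⊓-cong (+-cong r≈s r≈s) refl) j)
        (+-congʳ (β.at-cong (⊔-cong (+-congʳ (+-cong r≈s r≈s)) refl) j))

      continuous : ∀ r ε → 0# < ε → ∃[ δ ] (0# < δ ×
                   (∀ s → Near δ (proj₁ r) (proj₁ s) → ∀ j → Near ε (point r j) (point s j)))
      continuous r ε 0<ε with halve 0<ε
      ... | ε/2 , 0<ε/2 , ε/2+ε/2≤ε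
        with α.continuous (firstHalf r) ε/2 0<ε/2 | β.continuous (secondHalf r) ε/2 0<ε/2
      ... | δα , 0<δα , nearα | δβ , 0<δβ , nearβ with common-lower-bound 0<δα 0<δβ
      -- `ε` was halved for the two summands of `point`; `δ′` is halved because both
      -- reparametrisations double `r`.
      ... | δ′ , 0<δ′ , δ′≤δα , δ′≤δβ with halve 0<δ′
      ... | δ , 0<δ , δ+δ≤δ′ = δ , 0<δ , λ s r~s j →
        let 2r~2s = Near-weaken δ+δ≤δ′ (Near-+ r~s r~s) in
        Near-weaken ε/2+ε/2≤ε (Near-+
          (nearα (firstHalf s) (Near-weaken δ′≤δα (Near-⊓ 1# 0<δ′ 2r~2s)) j)
          (+-near _ (nearβ (secondHalf s) (Near-weaken δ′≤δβ (Near-⊔ 0# 0<δ′ (+-near (- 1#) 2r~2s))) j)))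

      path : Path K
      path = record
        { func = record { to = λ r → point r , point∈K r ; cong = λ {r} {s} → point-cong {r} {s} }
        ; continuous = continuous
        }

      path-start : proj₁ (at path 0ᴵ) ≋ proj₁ (α.at 0ᴵ)
      path-start = ≋-trans (point≋α 0ᴵ (x≤y⇒x⊔y≈y (2r-1≤r 0≤1)))
                      (α.at-cong (trans (x≤y⇒x⊓y≈x (≤-trans (≤-reflexive (+-identityˡ 0#)) 0≤1)) (+-identityˡ 0#)))

      path-end : proj₁ (at path 1ᴵ) ≋ proj₁ (β.at 1ᴵ)
      path-end = ≋-trans (point≋β 1ᴵ (x≤y⇒y⊓x≈x (x≤x+y 1# 0≤1)))
                    (β.at-cong (trans (⊔-cong (//-rightDividesʳ 1# 1#) refl) (x≤y⇒y⊔x≈y 0≤1)))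

      -- The first alternative carries no strict bound: α is completed at time 1/2, so even its
      -- endpoint is met before time 1.
      path-interior : ∀ r → r <1 → (∃[ s ] proj₁ (at path r) ≋ proj₁ (α.at s)) ⊎
                              (∃[ s ] (s <1 × proj₁ (at path r) ≋ proj₁ (β.at s)))
      path-interior r r<1 with firstHalf-or-secondHalf r
      ... | inj₁ secondHalf≈0 = inj₁ (firstHalf r , point≋α r secondHalf≈0)
      ... | inj₂ firstHalf≈1  = inj₂ (secondHalf r , secondHalf-<1 r r<1 , point≋β r firstHalf≈1)

    opaque

      prepend-cell-segment : ∀ {σ} → σ ∈ᴸ simplices K → ∀ {x y : Point K} →
        proj₁ x ∈ cell σ → proj₁ y ∈ cell σ → ∀ ((π , _) : PathFrom {K = K} x) →
        Σ[ (γ , _) ∈ PathFrom {K = K} y ]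
          (proj₁ (at γ 1ᴵ) ≋ proj₁ (at π 1ᴵ) ×
           (∀ r → r <1 → proj₁ (at γ r) ∈ cell σ ⊎ (∃[ s ] (s <1 × proj₁ (at γ r) ≋ proj₁ (at π s)))))
      prepend-cell-segment {σ} σ∈K {x} {y} x∈σ y∈σ (π , π₀≈x) =
        (path , ≋-trans path-start (segment-0 (proj₁ y) (proj₁ x))) , path-end ,
        λ r r<1 → Sum.map₁ (λ ((s , 0≤s , s≤1) , pathᵣ≈αₛ) →
          cell-resp-≋ σ (≋-sym pathᵣ≈αₛ) (cell-convex σ y∈σ x∈σ s 0≤s s≤1)) (path-interior r r<1)
        where
        α : Path K
        α = cell-segment σ∈K y x y∈σ x∈σ

        open Concatenation α π (≋-trans (segment-1 (proj₁ y) (proj₁ x)) (≋-sym π₀≈x))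

-- Invariance on cells, definability of classes, and matching of paths.

module Bisimilarity (em : ExcludedMiddle 0ℓ) (ℝ : CompleteOrderedField)
                    {PL : Set} {m : ℕ} {K : Polyhedral.SimplicialComplex ℝ m}
                    (𝒫 : Polyhedral.PolyhedralModel ℝ K PL) where

  open CompleteOrderedField ℝ using (setoid)
  open VecEquality setoid using (_≋_; ≋-refl; ≋-sym)
  open OrderedField ℝ using (0<1)
  open Coordinates ℝ using (cell-resp-≋)
  open Cells em ℝ
  open Paths ℝ
  open Polyhedral ℝ

  infix 4 _⊨_ _≡η_

  _⊨_ : Point K → Formula PL → Set
  x ⊨ Φ = x ⊨[ 𝒫 ] Φ

  _≡η_ : Point K → Point K → Set
  x ≡η y = x ≡η[ 𝒫 ] y

  CellInvariant : Formula PL → Set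
  CellInvariant Φ = ∀ {σ} → σ ∈ᴸ simplices K → ∀ x y →
                    proj₁ x ∈ cell σ → proj₁ y ∈ cell σ → x ⊨ Φ → y ⊨ Φ

  CellInvariant⇒resp-≋ : ∀ Φ → CellInvariant Φ → ∀ (x y : Point K) → proj₁ x ≋ proj₁ y → x ⊨ Φ → y ⊨ Φ
  CellInvariant⇒resp-≋ Φ invariant x y x≋y with point∈some-cell K x
  ... | σ , σ∈K , x∈σ = invariant σ∈K x y x∈σ (cell-resp-≋ σ x≋y x∈σ)

  -- A witnessing path from x is preceded by the segment from y to x,
  -- on which Φ holds since it holds at x and the segment stays in σ.
  η-cell-invariant : ∀ Φ Ψ → CellInvariant Φ → CellInvariant Ψ → CellInvariant (η Φ Ψ)
  η-cell-invariant Φ Ψ invariantΦ invariantΨ {σ} σ∈K x y x∈σ y∈σ (π , π₁⊨Ψ , π⊨Φ)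
    with prepend-cell-segment σ∈K {x} {y} x∈σ y∈σ π
  ... | γ , γ₁≋π₁ , γ<1 =
    γ , CellInvariant⇒resp-≋ Ψ invariantΨ (at (proj₁ π) 1ᴵ) (at (proj₁ γ) 1ᴵ) (≋-sym γ₁≋π₁) π₁⊨Ψ , γ⊨Φ
    where
    γ⊨Φ : ∀ r → r <1 → at (proj₁ γ) r ⊨ Φ
    γ⊨Φ r r<1 with γ<1 r r<1
    ... | inj₁ γᵣ∈σ = invariantΦ σ∈K x (at (proj₁ γ) r) x∈σ γᵣ∈σ
            (CellInvariant⇒resp-≋ Φ invariantΦ (at (proj₁ π) 0ᴵ) x (proj₂ π) (π⊨Φ 0ᴵ 0<1))
    ... | inj₂ (s , s<1 , γᵣ≋πₛ) =
            CellInvariant⇒resp-≋ Φ invariantΦ (at (proj₁ π) s) (at (proj₁ γ) r) (≋-sym γᵣ≋πₛ) (π⊨Φ s s<1)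

  cell-invariant : ∀ Φ → CellInvariant Φ
  cell-invariant (var p) σ∈K x y x∈σ y∈σ x⊨p with unionOfCells 𝒫 p
  ... | S , Vp⊆ , ⊆Vp with find (Vp⊆ x⊨p)
  -- The cell of `τ` witnessing `x ∈ V 𝒫 p` meets that of `σ` in `x`, hence also contains `y`.
  ... | τ , τ∈K , τ∈S , x∈τ = ⊆Vp {y} (lose τ∈K (τ∈S , meeting-cells K σ∈K τ∈K x∈σ x∈τ y∈σ))
  cell-invariant (¬ᶠ Φ) σ∈K x y x∈σ y∈σ x⊭Φ y⊨Φ = x⊭Φ (cell-invariant Φ σ∈K y x y∈σ x∈σ y⊨Φ)
  cell-invariant (Φ ∧ᶠ Ψ) σ∈K x y x∈σ y∈σ (x⊨Φ , x⊨Ψ) =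
    cell-invariant Φ σ∈K x y x∈σ y∈σ x⊨Φ , cell-invariant Ψ σ∈K x y x∈σ y∈σ x⊨Ψ
  cell-invariant (η Φ Ψ) = η-cell-invariant Φ Ψ (cell-invariant Φ) (cell-invariant Ψ)

  ⊨-resp-≋ : ∀ Φ (x y : Point K) → proj₁ x ≋ proj₁ y → x ⊨ Φ → y ⊨ Φ
  ⊨-resp-≋ Φ = CellInvariant⇒resp-≋ Φ (cell-invariant Φ)

  ≡η-sym : ∀ {x y} → x ≡η y → y ≡η x
  ≡η-sym x≡y Φ = ⇔-sym (x≡y Φ)

  ≡η-trans : ∀ {x y z} → x ≡η y → y ≡η z → x ≡η z
  ≡η-trans x≡y y≡z Φ = ⇔-trans (x≡y Φ) (y≡z Φ)

  ≋⇒≡η : ∀ {x y : Point K} → proj₁ x ≋ proj₁ y → x ≡η y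
  ≋⇒≡η {x} {y} x≋y Φ = mk⇔ (⊨-resp-≋ Φ x y x≋y) (⊨-resp-≋ Φ y x (≋-sym x≋y))

  distinguish : ∀ {x y} → ¬ (x ≡η y) → ∃[ Φ ] (x ⊨ Φ × ¬ (y ⊨ Φ))
  distinguish {x} {y} x≢y with em {∃[ Φ ] (x ⊨ Φ × ¬ (y ⊨ Φ))}
  ... | yes found = found
  ... | no none = contradiction (λ Φ → mk⇔ (to Φ) (from Φ)) x≢y
    where
    to : ∀ Φ → x ⊨ Φ → y ⊨ Φ
    to Φ x⊨Φ = decidable-stable em (λ y⊭Φ → none (Φ , x⊨Φ , y⊭Φ))

    from : ∀ Φ → y ⊨ Φ → x ⊨ Φ
    -- A formula that separates the points the wrong way round is negated.
    from Φ y⊨Φ = decidable-stable em (λ x⊭Φ → none (¬ᶠ Φ , x⊭Φ , λ y⊭Φ → y⊭Φ y⊨Φ))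

  -- Formula PL is empty when PL is, so a formula is needed to build ⊤ and ⊥.
  module Definability (Φ₀ : Formula PL) where

    ⊥ᶠ : Formula PL
    ⊥ᶠ = Φ₀ ∧ᶠ ¬ᶠ Φ₀

    ⊭⊥ᶠ : ∀ {x} → ¬ (x ⊨ ⊥ᶠ)
    ⊭⊥ᶠ (x⊨Φ₀ , x⊭Φ₀) = x⊭Φ₀ x⊨Φ₀

    -- Each cell adds at most one conjunct. If it contains some point not equivalent to `x`, a
    -- formula separating `x` from that one point fails on the entire cell.
    characteristic-among : ∀ x L → (∀ {σ} → σ ∈ᴸ L → σ ∈ᴸ simplices K) →
      ∃[ χ ] (x ⊨ χ × (∀ {σ y} → σ ∈ᴸ L → proj₁ y ∈ cell σ → y ⊨ χ → x ≡η y))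
    characteristic-among x [] L⊆K = ¬ᶠ ⊥ᶠ , ⊭⊥ᶠ {x} , λ ()
    characteristic-among x (σ ∷ L) L⊆K
      with characteristic-among x L (λ τ∈L → L⊆K (there τ∈L))
         | em {Σ[ y ∈ Point K ] (proj₁ y ∈ cell σ × ¬ (x ≡η y))}
    ... | χ , x⊨χ , χ⇒≡η | no none = χ , x⊨χ , λ
      { (here ≡.refl) y∈σ y⊨χ → decidable-stable em (λ x≢y → none (_ , y∈σ , x≢y))
      ; (there τ∈L) → χ⇒≡η τ∈L }
    ... | χ , x⊨χ , χ⇒≡η | yes (y , y∈σ , x≢y) with distinguish x≢y
    ... | Φ , x⊨Φ , y⊭Φ = χ ∧ᶠ Φ , (x⊨χ , x⊨Φ) , λ
      { {y = z} (here ≡.refl) z∈σ (_ , z⊨Φ) →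
          contradiction (cell-invariant Φ (L⊆K (here ≡.refl)) z y z∈σ y∈σ z⊨Φ) y⊭Φ
      ; (there τ∈L) y∈τ (y⊨χ , _) → χ⇒≡η τ∈L y∈τ y⊨χ }

    characteristic : ∀ x → ∃[ χ ] (x ⊨ χ × (∀ {y} → y ⊨ χ → x ≡η y))
    characteristic x with characteristic-among x (simplices K) (λ σ∈K → σ∈K)
    ... | χ , x⊨χ , χ⇒≡η = χ , x⊨χ , λ {y} y⊨χ →
      let σ , σ∈K , y∈σ = point∈some-cell K y in χ⇒≡η σ∈K y∈σ y⊨χ

    -- `P` is arbitrary, so it is captured only up to equivalence. Each cell meeting `P` adds one
    -- disjunct, the characteristic formula of a chosen point of `P` in it, which holds on the
    -- entire cell.
    saturation-among : (P : Pred (Point K) 0ℓ) → ∀ L → (∀ {σ} → σ ∈ᴸ L → σ ∈ᴸ simplices K) →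
      ∃[ Φ ] ((∀ {σ x} → σ ∈ᴸ L → proj₁ x ∈ cell σ → x ∈ P → x ⊨ Φ) ×
              (∀ {y} → y ⊨ Φ → Σ[ x ∈ Point K ] (x ∈ P × x ≡η y)))
    saturation-among P [] L⊆K = ⊥ᶠ , (λ ()) , λ {y} y⊨⊥ → contradiction y⊨⊥ (⊭⊥ᶠ {y})
    saturation-among P (σ ∷ L) L⊆K
      with saturation-among P L (λ τ∈L → L⊆K (there τ∈L))
         | em {Σ[ x ∈ Point K ] (proj₁ x ∈ cell σ × x ∈ P)}
    ... | Φ , P⇒Φ , Φ⇒P | no none = Φ , (λ
      { (here ≡.refl) x∈σ x∈P → contradiction (_ , x∈σ , x∈P) none
      ; (there τ∈L) → P⇒Φ τ∈L }) , Φ⇒P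
    ... | Φ , P⇒Φ , Φ⇒P | yes (x , x∈σ , x∈P) with characteristic x
    -- The disjunction of `Φ` and `χ`, by De Morgan.
    ... | χ , x⊨χ , χ⇒≡η = ¬ᶠ (¬ᶠ Φ ∧ᶠ ¬ᶠ χ) , (λ
      { {x = y} (here ≡.refl) y∈σ _ (_ , y⊭χ) →
          y⊭χ (cell-invariant χ (L⊆K (here ≡.refl)) x y x∈σ y∈σ x⊨χ)
      ; (there τ∈L) y∈τ y∈P (y⊭Φ , _) → y⊭Φ (P⇒Φ τ∈L y∈τ y∈P) }) , λ {y} y⊨Φ∨χ →
        decidable-stable em λ none → y⊨Φ∨χ
          ((λ y⊨Φ → none (Φ⇒P y⊨Φ)) , (λ y⊨χ → none (x , x∈P , χ⇒≡η y⊨χ)))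

    saturation : (P : Pred (Point K) 0ℓ) →
      ∃[ Φ ] ((∀ {x} → x ∈ P → x ⊨ Φ) × (∀ {y} → y ⊨ Φ → Σ[ x ∈ Point K ] (x ∈ P × x ≡η y)))
    saturation P with saturation-among P (simplices K) (λ σ∈K → σ∈K)
    ... | Φ , P⇒Φ , Φ⇒P = Φ , (λ {x} x∈P →
      let σ , σ∈K , x∈σ = point∈some-cell K x in P⇒Φ σ∈K x∈σ x∈P) , Φ⇒P

  Matches : Path K → Path K → Set
  Matches π₁ π₂ = at π₁ 1ᴵ ≡η at π₂ 1ᴵ × (∀ r₂ → r₂ <1 → ∃[ r₁ ] (r₁ <1 × at π₁ r₁ ≡η at π₂ r₂))

  matching-path : ∀ {x₁ x₂} → x₁ ≡η x₂ → ∀ ((π₁ , _) : PathFrom {K = K} x₁) →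
                  Σ[ (π₂ , _) ∈ PathFrom {K = K} x₂ ] Matches π₁ π₂
  matching-path {x₁} {x₂} x₁≡x₂ (π₁ , π₁₀≈x₁) with em {Formula PL}
  -- Without formulas all points are equivalent, so any path from `x₂` matches.
  ... | no ∄Φ = (constant x₂ , ≋-refl) , (λ Φ → contradiction Φ ∄Φ) ,
                λ _ _ → 0ᴵ , 0<1 , λ Φ → contradiction Φ ∄Φ
  ... | yes Φ₀
    with Definability.saturation Φ₀ (λ y → ∃[ r ] (r <1 × at π₁ r ≡η y))
       | Definability.characteristic Φ₀ (at π₁ 1ᴵ)
  ... | Φ , P⇒Φ , Φ⇒P | Ψ , π₁₁⊨Ψ , Ψ⇒≡η
    with Equivalence.to (x₁≡x₂ (η Φ Ψ))
           ((π₁ , π₁₀≈x₁) , π₁₁⊨Ψ , λ r r<1 → P⇒Φ (r , r<1 , λ _ → ⇔-refl))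
  ... | π₂ , π₂₁⊨Ψ , π₂⊨Φ = π₂ , Ψ⇒≡η π₂₁⊨Ψ , λ r₂ r₂<1 →
    let x , (r₁ , r₁<1 , π₁r₁≡x) , x≡π₂r₂ = Φ⇒P (π₂⊨Φ r₂ r₂<1)
    in r₁ , r₁<1 , ≡η-trans π₁r₁≡x x≡π₂r₂

  ≡η-isBisimulation : IsWeakSimplicialBisimulation 𝒫 _≡η_
  ≡η-isBisimulation = record
    { resp  = (λ {x} {y} {z} y≋z x≡y → ≡η-trans {x} {y} {z} x≡y (≋⇒≡η {y} {z} y≋z)) ,
              (λ {y} {x} {z} x≋z x≡y → ≡η-trans {z} {x} {y} (≋⇒≡η {z} {x} (≋-sym x≋z)) x≡y)
    ; sym   = λ {x} {y} → ≡η-sym {x} {y}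
    ; atoms = λ x≡y p → x≡y (var p)
    ; paths = matching-path
    }

  bisimulation-preserves : ∀ {B : Rel (Point K) 0ℓ} → IsWeakSimplicialBisimulation 𝒫 B →
                           ∀ Φ {x y} → B x y → x ⊨ Φ → y ⊨ Φ
  bisimulation-preserves {B} isBisimulation = preserves
    where
    open IsWeakSimplicialBisimulation isBisimulation

    preserves : ∀ Φ {x y} → B x y → x ⊨ Φ → y ⊨ Φ
    preserves (var p)  Bxy x⊨p           = Equivalence.to (atoms Bxy p) x⊨p
    -- Negation reverses the direction of preservation; symmetry of `B` restores it.
    preserves (¬ᶠ Φ)   Bxy x⊭Φ y⊨Φ       = x⊭Φ (preserves Φ (sym Bxy) y⊨Φ)
    preserves (Φ ∧ᶠ Ψ) Bxy (x⊨Φ , x⊨Ψ)   = preserves Φ Bxy x⊨Φ , preserves Ψ Bxy x⊨Ψ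
    -- Points of the new path are traced back to points of `π₁` before its end, where `Φ` is known;
    -- no monotonicity in the parameters is involved.
    preserves (η Φ Ψ)  Bxy (π₁ , π₁₁⊨Ψ , π₁⊨Φ) with paths Bxy π₁
    ... | π₂ , B₁ , below = π₂ , preserves Ψ B₁ π₁₁⊨Ψ , λ r₂ r₂<1 →
      let r₁ , r₁<1 , B₁₂ = below r₂ r₂<1 in preserves Φ B₁₂ (π₁⊨Φ r₁ r₁<1)

theorem2 : ExcludedMiddle 0ℓ →
    (ℝ : CompleteOrderedField) → let open Polyhedral ℝ in
    (PL : Set) (m : ℕ) (K : SimplicialComplex m) (𝒫 : PolyhedralModel K PL) (x₁ x₂ : Point K) →
    (x₁ ≡η[ 𝒫 ] x₂) ⇔ (x₁ ≈△[ 𝒫 ] x₂)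
theorem2 em ℝ PL m K 𝒫 x₁ x₂ = mk⇔
  (λ x₁≡x₂ → _≡η_ , ≡η-isBisimulation , x₁≡x₂)
  (λ (B , isBisimulation , Bx₁x₂) Φ → mk⇔
    (bisimulation-preserves isBisimulation Φ Bx₁x₂)
    (bisimulation-preserves isBisimulation Φ (IsWeakSimplicialBisimulation.sym isBisimulation Bx₁x₂)))
  where
  open Polyhedral ℝ using (IsWeakSimplicialBisimulation)
  open Bisimilarity em ℝ 𝒫
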